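{- Let $A$ be a finite alphabet, $p$ a prime, $u\in A^*$ a non-empty word, $\mathfrak{M}\in\mathbb{F}_p[q]$ a polynomial of degree at least $1$, and let $\cong$ be a congruence on $A^*$ that refines $\sim_{u,\mathfrak{M}}$. If $q$ is not a unit of $\mathbb{K}=\mathbb{F}_p[q]/\langle\mathfrak{M}\rangle$, then the monoid $A^*/{\cong}$ is not a group. In particular, no element of $A^*/{\cong}$ except for the identity is invertible.
   Context: $A^*$ is the free monoid of finite words over $A$ (with concatenation and empty word $\varepsilon$), and $|w|$ is the length of a word $w$. The $q$-binomial coefficient $\binom{u}{v}_q\in\mathbb{N}[q]$ of two words $u,v\in A^*$ is defined recursively by $\binom{u}{\varepsilon}_q=1$, $\binom{\varepsilon}{v}_q=0$ if $v\neq\varepsilon$, and, for all $u,v\in A^*$ and letters $a,b\in A$, $\binom{ua}{vb}_q=q^{|vb|}\binom{u}{vb}_q+\delta_{a,b}\binom{u}{v}_q$, where $\delta_{a,b}$ is the Kronecker delta. The integer coefficients of $\binom{u}{v}_q$ are reduced modulo $p$ to view it in $\mathbb{F}_p[q]$. $\operatorname{Fac}(u)$ is the set of factors of $u$, i.e. the words $f$ with $u=xfs$ for some $x,s\in A^*$. Write $w_1\sim_{u,\mathfrak{M}}w_2$ if $\binom{w_1}{v}_q\equiv\binom{w_2}{v}_q\pmod{\mathfrak{M}}$ for all $v\in\operatorname{Fac}(u)$. A congruence on $A^*$ is an equivalence relation compatible with concatenation on both sides. An equivalence relation $\cong$ refines $\sim$ if $w_1\cong w_2$ implies $w_1\sim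 w_2$. -}

module Defs where

open import Algebra.Bundles
  using (Monoid; CommutativeMonoid; CommutativeSemiring; CommutativeRing)
open import Algebra.Structures using (IsGroup; IsCommutativeSemiring)
open import Algebra.Structures.Biased using (isCommutativeSemiringˡ)
import Algebra.Definitions as Definitions
import Algebra.Definitions.RawMagma as RawMagmaDefinitions
import Algebra.Properties.Semiring.Exp as Exp
import Algebra.Properties.Ring as RingProperties
import Algebra.Properties.CommutativeSemigroup as CommutativeSemigroupProperties
open import Data.Bool.Base using (if_then_else_)
open import Data.Fin.Base using (Fin)
import Data.Fin.Properties as Fin
open import Data.Integer.Base using (+_)
import Data.Integer.Properties as ℤ
open import Data.List.Base
  using (List; []; _∷_; _++_; _∷ʳ_; map; length; reverse)
open import Data.List.Properties
  using (++-assoc; ++-identityˡ; ++-identityʳ; reverse-++; length-reverse)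
open import Data.Nat.Base using (ℕ; zero; suc; _<_)
import Data.Nat.Properties as ℕ
open import Data.Product.Base using (∃; ∃₂; _×_; _,_)
open import Function.Base using (_$_)
open import Function.Bundles using (_↔_)
open import Function.Properties.Inverse using (↔⇒↣)
open import Level using (Level; 0ℓ; _⊔_)
open import Relation.Binary.Core using (Rel)
open import Relation.Binary.Definitions using (DecidableEquality)
open import Relation.Binary.Structures using (IsEquivalence)
import Relation.Binary.Reasoning.Setoid as SetoidReasoning
open import Relation.Binary.PropositionalEquality as ≡ using (_≡_; refl)
open import Relation.Nullary using (¬_)
open import Relation.Nullary.Decidable.Core using (does)
open import Relation.Nullary.Decidable using (via-injection)

private
  variable
    a c ℓ : Level

------------------------------------------------------------------------
-- Univariate polynomials

-- A polynomial is the list of its coefficients, constant term first;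
-- trailing zeros are allowed, so equality is coefficientwise.

module Polynomial (R : CommutativeSemiring c ℓ) where

  private
    module R = CommutativeSemiring R
  open R using (0#; 1#; _≈_; _≉_)

  Poly : Set c
  Poly = List R.Carrier

  coeff : Poly → ℕ → R.Carrier
  coeff []      _       = 0#
  coeff (a ∷ _) zero    = a
  coeff (_ ∷ f) (suc n) = coeff f n

  infix 4 _≋_
  record _≋_ (f g : Poly) : Set ℓ where
    constructor coeffwise
    field at : ∀ n → coeff f n ≈ coeff g n
  open _≋_ public

  HasDegree : Poly → ℕ → Set ℓ
  HasDegree f d = coeff f d ≉ 0# × (∀ n → d < n → coeff f n ≈ 0#)

  infixl 6 _+_
  infixl 7 _*_ _·_

  _+_ : Poly → Poly → Poly
  []      + g       = g
  (a ∷ f) + []      = a ∷ f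
  (a ∷ f) + (b ∷ g) = (a R.+ b) ∷ (f + g)

  _·_ : R.Carrier → Poly → Poly
  a · f = map (a R.*_) f

  _*_ : Poly → Poly → Poly
  []      * g = []
  (a ∷ f) * g = a · g + (0# ∷ f * g)

  𝟘 𝟙 X : Poly
  𝟘 = []
  𝟙 = 1# ∷ []
  X = 0# ∷ 1# ∷ []

  coeff-+ : ∀ f g n → coeff (f + g) n ≈ coeff f n R.+ coeff g n
  coeff-+ []      g       n       = R.sym (R.+-identityˡ _)
  coeff-+ (a ∷ f) []      n       = R.sym (R.+-identityʳ _)
  coeff-+ (a ∷ f) (b ∷ g) zero    = R.refl
  coeff-+ (a ∷ f) (b ∷ g) (suc n) = coeff-+ f g n

  coeff-· : ∀ a f n → coeff (a · f) n ≈ a R.* coeff f n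
  coeff-· a []      n       = R.sym (R.zeroʳ a)
  coeff-· a (b ∷ f) zero    = R.refl
  coeff-· a (b ∷ f) (suc n) = coeff-· a f n

  ≋-isEquivalence : IsEquivalence _≋_
  ≋-isEquivalence = record
    { refl  = coeffwise λ _ → R.refl
    ; sym   = λ e → coeffwise λ n → R.sym (at e n)
    ; trans = λ e e′ → coeffwise λ n → R.trans (at e n) (at e′ n)
    }

  open IsEquivalence ≋-isEquivalence public
    renaming (refl to ≋-refl; sym to ≋-sym; trans to ≋-trans)

  ∷-cong : ∀ {a b f g} → a ≈ b → f ≋ g → a ∷ f ≋ b ∷ g
  ∷-cong a≈b f≋g = coeffwise λ { zero → a≈b ; (suc n) → at f≋g n }

  0∷𝟘 : 0# ∷ 𝟘 ≋ 𝟘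
  0∷𝟘 = coeffwise λ { zero → R.refl ; (suc n) → R.refl }

  +-cong : Definitions.Congruent₂ _≋_ _+_
  +-cong {f} {f′} {g} {g′} e e′ = coeffwise λ n →
    R.trans (coeff-+ f g n) $
    R.trans (R.+-cong (at e n) (at e′ n)) $
    R.sym (coeff-+ f′ g′ n)

  +-comm : Definitions.Commutative _≋_ _+_
  +-comm f g = coeffwise λ n →
    R.trans (coeff-+ f g n) $
    R.trans (R.+-comm _ _) $
    R.sym (coeff-+ g f n)

  +-assoc : Definitions.Associative _≋_ _+_
  +-assoc f g h = coeffwise λ n →
    R.trans (coeff-+ (f + g) h n) $
    R.trans (R.+-congʳ (coeff-+ f g n)) $
    R.trans (R.+-assoc _ _ _) $
    R.sym (R.trans (coeff-+ f (g + h) n) (R.+-congˡ (coeff-+ g h n)))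

  +-identityʳ : Definitions.RightIdentity _≋_ 𝟘 _+_
  +-identityʳ f = +-comm f 𝟘

  +-commutativeMonoid : CommutativeMonoid c ℓ
  +-commutativeMonoid = record
    { isCommutativeMonoid = record
      { isMonoid = record
        { isSemigroup = record
          { isMagma = record { isEquivalence = ≋-isEquivalence ; ∙-cong = +-cong }
          ; assoc   = +-assoc
          }
        ; identity = (λ _ → ≋-refl) , +-identityʳ
        }
      ; comm = +-comm
      }
    }

  private
    module +M = CommutativeMonoid +-commutativeMonoid
  open CommutativeSemigroupProperties +M.commutativeSemigroup
    using (x∙yz≈y∙xz; interchange)
  open SetoidReasoning +M.setoid

  ·-cong : ∀ {a b f g} → a ≈ b → f ≋ g → a · f ≋ b · g
  ·-cong {a} {b} {f} {g} e e′ = coeffwise λ n →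
    R.trans (coeff-· a f n) $
    R.trans (R.*-cong e (at e′ n)) $
    R.sym (coeff-· b g n)

  0· : ∀ f → 0# · f ≋ 𝟘
  0· f = coeffwise λ n → R.trans (coeff-· 0# f n) (R.zeroˡ _)

  1· : ∀ f → 1# · f ≋ f
  1· f = coeffwise λ n → R.trans (coeff-· 1# f n) (R.*-identityˡ _)

  ·-assoc : ∀ a b f → (a R.* b) · f ≋ a · (b · f)
  ·-assoc a b f = coeffwise λ n →
    R.trans (coeff-· (a R.* b) f n) $
    R.trans (R.*-assoc _ _ _) $
    R.sym (R.trans (coeff-· a (b · f) n) (R.*-congˡ (coeff-· b f n)))

  ·-distribˡ : ∀ a f g → a · (f + g) ≋ a · f + a · g
  ·-distribˡ a f g = coeffwise λ n →
    R.trans (coeff-· a (f + g) n) $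
    R.trans (R.*-congˡ (coeff-+ f g n)) $
    R.trans (R.distribˡ _ _ _) $
    R.sym (R.trans (coeff-+ (a · f) (a · g) n)
                   (R.+-cong (coeff-· a f n) (coeff-· a g n)))

  ·-distribʳ : ∀ a b f → (a R.+ b) · f ≋ a · f + b · f
  ·-distribʳ a b f = coeffwise λ n →
    R.trans (coeff-· (a R.+ b) f n) $
    R.trans (R.distribʳ _ _ _) $
    R.sym (R.trans (coeff-+ (a · f) (b · f) n)
                   (R.+-cong (coeff-· a f n) (coeff-· b f n)))

  *-zeroʳ : Definitions.RightZero _≋_ 𝟘 _*_
  *-zeroʳ []      = ≋-refl
  *-zeroʳ (a ∷ f) = ≋-trans (∷-cong R.refl (*-zeroʳ f)) 0∷𝟘

  *-congˡ : ∀ f {g h} → g ≋ h → f * g ≋ f * h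
  *-congˡ []      e = ≋-refl
  *-congˡ (a ∷ f) e = +-cong (·-cong R.refl e) (∷-cong R.refl (*-congˡ f e))

  *-∷ : ∀ f b g → f * (b ∷ g) ≋ b · f + (0# ∷ f * g)
  *-∷ []      b g = ≋-sym 0∷𝟘
  *-∷ (a ∷ f) b g = ∷-cong (R.+-congʳ (R.*-comm a b)) $ begin
    a · g + f * (b ∷ g)              ≈⟨ +-cong ≋-refl (*-∷ f b g) ⟩
    a · g + (b · f + (0# ∷ f * g))   ≈⟨ x∙yz≈y∙xz (a · g) (b · f) (0# ∷ f * g) ⟩
    b · f + (a · g + (0# ∷ f * g))   ∎

  *-comm : Definitions.Commutative _≋_ _*_
  *-comm []      g = ≋-sym (*-zeroʳ g)
  *-comm (a ∷ f) g = begin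
    a · g + (0# ∷ f * g)  ≈⟨ +-cong ≋-refl (∷-cong R.refl (*-comm f g)) ⟩
    a · g + (0# ∷ g * f)  ≈⟨ *-∷ g a f ⟨
    g * (a ∷ f)           ∎

  *-cong : Definitions.Congruent₂ _≋_ _*_
  *-cong {f} {f′} {g} {g′} e e′ = begin
    f * g    ≈⟨ *-congˡ f e′ ⟩
    f * g′   ≈⟨ *-comm f g′ ⟩
    g′ * f   ≈⟨ *-congˡ g′ e ⟩
    g′ * f′  ≈⟨ *-comm g′ f′ ⟩
    f′ * g′  ∎

  *-distribʳ : Definitions._DistributesOverʳ_ _≋_ _*_ _+_
  *-distribʳ h []      g       = ≋-refl
  *-distribʳ h (a ∷ f) []      = ≋-sym (+-identityʳ _)
  *-distribʳ h (a ∷ f) (b ∷ g) = begin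
    (a R.+ b) · h + (0# ∷ (f + g) * h)
      ≈⟨ +-cong (·-distribʳ a b h)
           (∷-cong (R.sym (R.+-identityˡ 0#)) (*-distribʳ h f g)) ⟩
    (a · h + b · h) + ((0# ∷ f * h) + (0# ∷ g * h))
      ≈⟨ interchange (a · h) (b · h) (0# ∷ f * h) (0# ∷ g * h) ⟩
    (a · h + (0# ∷ f * h)) + (b · h + (0# ∷ g * h))  ∎

  ·-* : ∀ a f g → (a · f) * g ≋ a · (f * g)
  ·-* a []      g = ≋-refl
  ·-* a (b ∷ f) g = begin
    (a R.* b) · g + (0# ∷ (a · f) * g)
      ≈⟨ +-cong (·-assoc a b g) (∷-cong (R.sym (R.zeroʳ a)) (·-* a f g)) ⟩
    a · (b · g) + a · (0# ∷ f * g)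
      ≈⟨ ·-distribˡ a (b · g) (0# ∷ f * g) ⟨
    a · (b · g + (0# ∷ f * g))  ∎

  *-assoc : Definitions.Associative _≋_ _*_
  *-assoc []      g h = ≋-refl
  *-assoc (a ∷ f) g h = begin
    (a · g + (0# ∷ f * g)) * h
      ≈⟨ *-distribʳ h (a · g) (0# ∷ f * g) ⟩
    (a · g) * h + (0# · h + (0# ∷ f * g * h))
      ≈⟨ +-cong (·-* a g h) (+-cong (0· h) (∷-cong R.refl (*-assoc f g h))) ⟩
    a · (g * h) + (0# ∷ f * (g * h))  ∎

  *-identityˡ : Definitions.LeftIdentity _≋_ 𝟙 _*_
  *-identityˡ f = ≋-trans (+-cong (1· f) 0∷𝟘) (+-identityʳ f)

  *-identityʳ : Definitions.RightIdentity _≋_ 𝟙 _*_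
  *-identityʳ f = ≋-trans (*-comm f 𝟙) (*-identityˡ f)

  isCommutativeSemiring : IsCommutativeSemiring _≋_ _+_ _*_ 𝟘 𝟙
  isCommutativeSemiring = isCommutativeSemiringˡ record
    { +-isCommutativeMonoid = +M.isCommutativeMonoid
    ; *-isCommutativeMonoid = record
      { isMonoid = record
        { isSemigroup = record
          { isMagma = record { isEquivalence = ≋-isEquivalence ; ∙-cong = *-cong }
          ; assoc   = *-assoc
          }
        ; identity = *-identityˡ , *-identityʳ
        }
      ; comm = *-comm
      }
    ; distribʳ = *-distribʳ
    ; zeroˡ    = λ _ → ≋-refl
    }

  commutativeSemiring : CommutativeSemiring c ℓ
  commutativeSemiring = record { isCommutativeSemiring = isCommutativeSemiring }

infix 9 _[X]

_[X] : CommutativeRing c ℓ → CommutativeRing c ℓ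
R [X] = record
  { -_ = map R.neg
  ; isCommutativeRing = record
    { isRing = record
      { +-isAbelianGroup = record
        { isGroup = record
          { isMonoid = S.+-isMonoid
          ; inverse  = (λ f → ≋-trans (P.+-comm (map R.neg f) f) (inverseʳ f)) , inverseʳ
          ; ⁻¹-cong  = λ {f} {g} e → P.coeffwise λ n →
              R.trans (coeff-neg f n) $
              R.trans (R.-‿cong (P.at e n)) $
              R.sym (coeff-neg g n)
          }
        ; comm = P.+-comm
        }
      ; *-cong     = P.*-cong
      ; *-assoc    = P.*-assoc
      ; *-identity = S.*-identity
      ; distrib    = S.distrib
      }
    ; *-comm = P.*-comm
    }
  }
  where
  module R = CommutativeRing R renaming (-_ to neg)
  module P = Polynomial R.commutativeSemiring
  module S = IsCommutativeSemiring P.isCommutativeSemiring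
  open P using (coeff; ≋-trans)

  coeff-neg : ∀ f n → coeff (map R.neg f) n R.≈ R.neg (coeff f n)
  coeff-neg []      n       = R.sym (RingProperties.-0#≈0# R.ring)
  coeff-neg (a ∷ f) zero    = R.refl
  coeff-neg (a ∷ f) (suc n) = coeff-neg f n

  inverseʳ : ∀ f → (f P.+ map R.neg f) P.≋ P.𝟘
  inverseʳ f = P.coeffwise λ n →
    R.trans (P.coeff-+ f (map R.neg f) n) $
    R.trans (R.+-congˡ (coeff-neg f n)) $
    R.-‿inverseʳ _

------------------------------------------------------------------------
-- The quotient of a commutative ring by a principal ideal

infixl 8 _/⟨_⟩

_/⟨_⟩ : (R : CommutativeRing c ℓ) → CommutativeRing.Carrier R →
        CommutativeRing c (c ⊔ ℓ)
R /⟨ m ⟩ = record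
  { _≈_ = _≡ₘ_
  ; _+_ = _+_
  ; _*_ = _*_
  ; -_  = -_
  ; 0#  = 0#
  ; 1#  = 1#
  ; isCommutativeRing = record
    { isRing = record
      { +-isAbelianGroup = record
        { isGroup = record
          { isMonoid = record
            { isSemigroup = record
              { isMagma = record
                { isEquivalence = record
                  { refl  = lift refl′
                  ; sym   = λ {x} {y} d → resp (negate x y) (∣-scale (- 1#) d)
                  ; trans = λ {x} {y} {z} d e → resp (telescope x y z) (∣-add d e)
                  }
                ; ∙-cong = λ {x} {y} {u} {v} d e → resp (sums x y u v) (∣-add d e)
                }
              ; assoc = λ x y z → lift (+-assoc x y z)
              }
            ; identity = (λ x → lift (+-identityˡ x)) , (λ x → lift (+-identityʳ x))
            }
          ; inverse = (λ x → lift (-‿inverseˡ x)) , (λ x → lift (-‿inverseʳ x))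
          ; ⁻¹-cong = λ {x} {y} d → resp (negations x y) (∣-scale (- 1#) d)
          }
        ; comm = λ x y → lift (+-comm x y)
        }
      ; *-cong = λ {x} {y} {u} {v} d e →
          resp (products x y u v) (∣-add (∣-scale u d) (∣-scale y e))
      ; *-assoc = λ x y z → lift (*-assoc x y z)
      ; *-identity = (λ x → lift (*-identityˡ x)) , (λ x → lift (*-identityʳ x))
      ; distrib = (λ x y z → lift (distribˡ x y z)) , (λ x y z → lift (distribʳ x y z))
      }
    ; *-comm = λ x y → lift (*-comm x y)
    }
  }
  where
  open CommutativeRing R renaming (refl to refl′)
  open RawMagmaDefinitions *-rawMagma using (_∣_; _,_)
  open RingProperties ring using (-‿distribʳ-*; -1*x≈-x; -‿+-comm; ⁻¹-anti-homo‿-)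
  open CommutativeSemigroupProperties
    (CommutativeMonoid.commutativeSemigroup +-commutativeMonoid)
    using (interchange)
  open SetoidReasoning setoid

  _≡ₘ_ : Rel Carrier _
  x ≡ₘ y = m ∣ (x - y)

  resp : ∀ {x y} → x ≈ y → m ∣ x → m ∣ y
  resp x≈y (k , e) = k , trans e x≈y

  lift : ∀ {x y} → x ≈ y → x ≡ₘ y
  lift {x} {y} x≈y = 0# , (begin
    0# * m  ≈⟨ zeroˡ m ⟩
    0#      ≈⟨ -‿inverseʳ y ⟨
    y - y   ≈⟨ +-congʳ x≈y ⟨
    x - y   ∎)

  ∣-add : ∀ {x y} → m ∣ x → m ∣ y → m ∣ (x + y)
  ∣-add (k , e) (l , f) = (k + l) , trans (distribʳ m k l) (+-cong e f)

  ∣-scale : ∀ {x} z → m ∣ x → m ∣ (z * x)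
  ∣-scale z (k , e) = (z * k) , trans (*-assoc z k m) (*-congˡ e)

  negate : ∀ x y → - 1# * (x - y) ≈ y - x
  negate x y = trans (-1*x≈-x _) (⁻¹-anti-homo‿- x y)

  telescope : ∀ x y z → (x - y) + (y - z) ≈ x - z
  telescope x y z = begin
    (x - y) + (y - z)    ≈⟨ +-assoc x (- y) (y - z) ⟩
    x + (- y + (y - z))  ≈⟨ +-congˡ (+-assoc (- y) y (- z)) ⟨
    x + (- y + y - z)    ≈⟨ +-congˡ (+-congʳ (-‿inverseˡ y)) ⟩
    x + (0# - z)         ≈⟨ +-congˡ (+-identityˡ (- z)) ⟩
    x - z                ∎

  sums : ∀ x y u v → (x - y) + (u - v) ≈ (x + u) - (y + v)
  sums x y u v = trans (interchange x (- y) u (- v)) (+-congˡ (-‿+-comm y v))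

  negations : ∀ x y → - 1# * (x - y) ≈ (- x) - (- y)
  negations x y = trans (-1*x≈-x _) (sym (-‿+-comm x (- y)))

  *-minus : ∀ x y z → x * (y - z) ≈ x * y - x * z
  *-minus x y z = trans (distribˡ x y (- z)) (+-congˡ (sym (-‿distribʳ-* x z)))

  products : ∀ x y u v → u * (x - y) + y * (u - v) ≈ x * u - y * v
  products x y u v = begin
    u * (x - y) + y * (u - v)          ≈⟨ +-cong (*-minus u x y) (*-minus y u v) ⟩
    (u * x - u * y) + (y * u - y * v)  ≈⟨ +-congʳ (+-cong (*-comm u x) (-‿cong (*-comm u y))) ⟩
    (x * u - y * u) + (y * u - y * v)  ≈⟨ telescope (x * u) (y * u) (y * v) ⟩
    x * u - y * v                      ∎

IsUnit : (R : CommutativeRing c ℓ) → CommutativeRing.Carrier R → Set (c ⊔ ℓ)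
IsUnit R = Definitions.Invertible _≈_ 1# _*_
  where open CommutativeRing R

------------------------------------------------------------------------
-- ℕ[q], 𝔽ₚ[q] and 𝕂 = 𝔽ₚ[q] / ⟨ 𝔐 ⟩

module ℕ[q] where
  open Polynomial ℕ.+-*-commutativeSemiring public renaming (X to q)
  open Exp (CommutativeSemiring.semiring commutativeSemiring) public using (_^_)

-- A field when p is prime.  Residues are represented by arbitrary integers,
-- equal when p divides their difference.
𝔽 : ℕ → CommutativeRing 0ℓ 0ℓ
𝔽 p = ℤ.+-*-commutativeRing /⟨ + p ⟩

module 𝔽[q] (p : ℕ) where
  open Polynomial (CommutativeRing.commutativeSemiring (𝔽 p)) public renaming (X to q)

𝕂 : (p : ℕ) → 𝔽[q].Poly p → CommutativeRing 0ℓ 0ℓ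
𝕂 p 𝔐 = 𝔽 p [X] /⟨ 𝔐 ⟩

-- Reduction of the coefficients modulo p; the identification of congruent
-- integers is in the equality of 𝔽 p.
reduce : (p : ℕ) → ℕ[q].Poly → 𝔽[q].Poly p
reduce p = map +_

------------------------------------------------------------------------
-- q-binomial coefficients of words

module QBinomial {A : Set a} (_≟_ : DecidableEquality A) where
  open ℕ[q]

  δ : A → A → Poly
  δ a b = if does (a ≟ b) then 𝟙 else 𝟘

  -- The defining recursion removes last letters, so it is carried out on
  -- the reversed words, where it is structural.
  binomʳ : List A → List A → Poly
  binomʳ _       []      = 𝟙
  binomʳ []      (_ ∷ _) = 𝟘
  binomʳ (a ∷ u) (b ∷ v) =
    q ^ length (b ∷ v) * binomʳ u (b ∷ v) + δ a b * binomʳ u v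

  binom : List A → List A → Poly
  binom u v = binomʳ (reverse u) (reverse v)

  binom-ε : ∀ u → binom u [] ≡ 𝟙
  binom-ε u with reverse u
  ... | []    = refl
  ... | _ ∷ _ = refl

  binom-ε-∷ʳ : ∀ v b → binom [] (v ∷ʳ b) ≡ 𝟘
  binom-ε-∷ʳ v b rewrite reverse-++ v (b ∷ []) = refl

  binom-∷ʳ-∷ʳ : ∀ u v a b → binom (u ∷ʳ a) (v ∷ʳ b) ≡
    q ^ length (v ∷ʳ b) * binom u (v ∷ʳ b) + δ a b * binom u v
  binom-∷ʳ-∷ʳ u v a b
    rewrite ≡.sym (length-reverse (v ∷ʳ b))
          | reverse-++ u (a ∷ [])
          | reverse-++ v (b ∷ []) = refl

------------------------------------------------------------------------
-- Relations on words

Fac : {A : Set a} → List A → List A → Set a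
Fac u f = ∃₂ λ x s → u ≡ x ++ f ++ s

finite⇒≟ : {A : Set a} {k : ℕ} → A ↔ Fin k → DecidableEquality A
finite⇒≟ fin = via-injection (↔⇒↣ fin) Fin._≟_

module _ {A : Set a} (_≟_ : DecidableEquality A)
         (p : ℕ) (u : List A) (𝔐 : 𝔽[q].Poly p) where
  open QBinomial _≟_ using (binom)
  open CommutativeRing (𝕂 p 𝔐) using (_≈_)

  Sim : Rel (List A) a
  Sim w₁ w₂ = ∀ v → Fac u v → reduce p (binom w₁ v) ≈ reduce p (binom w₂ v)

record IsCongruence {A : Set a} (_≅_ : Rel (List A) ℓ) : Set (a ⊔ ℓ) where
  field
    isEquivalence : IsEquivalence _≅_
    ++-congˡ      : Definitions.LeftCongruent _≅_ _++_
    ++-congʳ      : Definitions.RightCongruent _≅_ _++_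

quotientMonoid : {A : Set a} {_≅_ : Rel (List A) ℓ} → IsCongruence _≅_ → Monoid a ℓ
quotientMonoid {A = A} {_≅_ = _≅_} c = record
  { Carrier  = List A
  ; _≈_      = _≅_
  ; _∙_      = _++_
  ; ε        = []
  ; isMonoid = record
    { isSemigroup = record
      { isMagma = record
        { isEquivalence = isEquivalence
        ; ∙-cong        = λ d e → trans (++-congʳ d) (++-congˡ e)
        }
      ; assoc = λ x y z → reflexive (++-assoc x y z)
      }
    ; identity = (λ x → reflexive (++-identityˡ x)) , (λ x → reflexive (++-identityʳ x))
    }
  }
  where
  open IsCongruence c
  open IsEquivalence isEquivalence using (trans; reflexive)

IsGroupMonoid : Monoid c ℓ → Set (c ⊔ ℓ)
IsGroupMonoid M = ∃ λ _⁻¹ → IsGroup _≈_ _∙_ ε _⁻¹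
  where open Monoid M

InvertibleIn : (M : Monoid c ℓ) → Monoid.Carrier M → Set (c ⊔ ℓ)
InvertibleIn M = Definitions.Invertible _≈_ ε _∙_
  where open Monoid M

{-# OPTIONS --safe #-}

-- Let a be the first letter of u.  Prefixing a letter a to a word x gives
-- binom (ax) a = q^|x| + binom x a.  If w v ≅ ε, then also a w v ≅ a, and
-- comparing the binomials over a of both pairs yields q^|wv| = 1 in 𝕂.  Since
-- q is not a unit, |wv| = 0; hence only the empty word is invertible.

module Submission where

open import Defs
open import Algebra.Bundles using (CommutativeRing; CommutativeSemiring)
open import Algebra.Properties.AbelianGroup using (x≈y⇒x∙y⁻¹≈ε)
import Algebra.Definitions.RawMagma as RawMagmaDefinitions
import Algebra.Properties.Ring as RingProperties
open import Algebra.Structures using (IsGroup)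
open import Data.Fin.Base using (Fin)
import Data.Integer.Base as ℤ
import Data.Integer.Properties as ℤ
open import Data.List.Base using (List; []; _∷_; _++_; _∷ʳ_; length; reverse)
open import Data.List.Properties
  using (++-conicalˡ; length-reverse; map-∘; map-cong; unfold-reverse)
open import Data.Nat.Base as ℕ using (ℕ; zero; suc; _≤_)
open import Data.Nat.Primality using (Prime)
open import Data.Product.Base using (_×_; _,_)
open import Function.Base using (_$_)
open import Function.Bundles using (_↔_)
open import Relation.Binary.Core using (Rel; _⇒_)
open import Relation.Binary.Definitions using (DecidableEquality)
open import Relation.Binary.PropositionalEquality
  using (_≡_; _≢_; refl; sym; trans; cong; cong₂)
import Relation.Binary.Reasoning.Setoid as SetoidReasoning
open import Relation.Binary.Structures using (IsEquivalence)
open import Relation.Nullary using (¬_; contradiction)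
open import Relation.Nullary.Decidable using (dec-true)

-- The difference of equal elements is zero, which is the multiple `0# * m`.
≈⇒≈/⟨⟩ : ∀ {c ℓ} (R : CommutativeRing c ℓ) (m : CommutativeRing.Carrier R) →
  CommutativeRing._≈_ R ⇒ CommutativeRing._≈_ (R /⟨ m ⟩)
≈⇒≈/⟨⟩ R m x≈y =
  R.0# RawMagmaDefinitions., R.trans (R.zeroˡ m) (R.sym (x≈y⇒x∙y⁻¹≈ε R.+-abelianGroup x≈y))
  where module R = CommutativeRing R

module _ (p : ℕ) where
  private
    module P = 𝔽[q] p
    module F = CommutativeRing (𝔽 p)

  -- This is an equality of lists, since `𝔽 p` adds representatives as integers and the sum of two
  -- naturals in ℤ computes.
  reduce-+ : ∀ f g → reduce p (f ℕ[q].+ g) ≡ reduce p f P.+ reduce p g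
  reduce-+ []      g       = refl
  reduce-+ (a ∷ f) []      = refl
  reduce-+ (a ∷ f) (b ∷ g) = cong (ℤ.+ (a ℕ.+ b) ∷_) (reduce-+ f g)

  reduce-· : ∀ a f → reduce p (a ℕ[q].· f) ≡ (ℤ.+ a) P.· reduce p f
  reduce-· a f =
    trans (sym (map-∘ f)) (trans (map-cong (ℤ.pos-* a) f) (map-∘ f))

  reduce-* : ∀ f g → reduce p (f ℕ[q].* g) ≡ reduce p f P.* reduce p g
  reduce-* []      g = refl
  reduce-* (a ∷ f) g = trans
    (reduce-+ (a ℕ[q].· g) (0 ∷ f ℕ[q].* g))
    (cong₂ P._+_ (reduce-· a g) (cong (ℤ.+ 0 ∷_) (reduce-* f g)))

  coeff-reduce : ∀ f n → P.coeff (reduce p f) n ≡ ℤ.+ ℕ[q].coeff f n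
  coeff-reduce []      n       = refl
  coeff-reduce (a ∷ f) zero    = refl
  coeff-reduce (a ∷ f) (suc n) = coeff-reduce f n

  -- Needed because the identities between q-binomials hold only up to trailing zeros.
  reduce-cong : ∀ {f g} → f ℕ[q].≋ g → reduce p f P.≋ reduce p g
  reduce-cong {f} {g} f≋g = P.coeffwise λ n → F.reflexive $
    trans (coeff-reduce f n) $
    trans (cong ℤ.+_ (ℕ[q].at f≋g n)) $
    sym (coeff-reduce g n)

  module _ (𝔐 : P.Poly) where
    open CommutativeRing (𝕂 p 𝔐) using (_≈_; 1#; *-comm; setoid)
    open SetoidReasoning setoid

    q^n≈1⇒IsUnit-q : ∀ n → n ≢ 0 → reduce p (ℕ[q].q ℕ[q].^ n) ≈ 1# →
                     IsUnit (𝕂 p 𝔐) P.q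
    q^n≈1⇒IsUnit-q zero    n≢0 _     = contradiction refl n≢0
    q^n≈1⇒IsUnit-q (suc n) _   q^n≈1 =
      q⁻¹ , q⁻¹q≈1 , qq⁻¹≈1
      where
      q⁻¹ = reduce p (ℕ[q].q ℕ[q].^ n)

      qq⁻¹≈1 : P.q P.* q⁻¹ ≈ 1#
      qq⁻¹≈1 = begin
        P.q P.* q⁻¹                     ≡⟨ reduce-* ℕ[q].q (ℕ[q].q ℕ[q].^ n) ⟨
        -- The power unfolds to `q * q ^ n`, so the preceding power of `q` serves as the inverse.
        reduce p (ℕ[q].q ℕ[q].^ suc n)  ≈⟨ q^n≈1 ⟩
        1#                              ∎

      q⁻¹q≈1 : q⁻¹ P.* P.q ≈ 1#
      q⁻¹q≈1 = begin
        q⁻¹ P.* P.q  ≈⟨ *-comm q⁻¹ P.q ⟩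
        P.q P.* q⁻¹  ≈⟨ qq⁻¹≈1 ⟩
        1#           ∎

module _ {a} {A : Set a} (_≟_ : DecidableEquality A) where
  open QBinomial _≟_
  open ℕ[q]
  open CommutativeSemiring commutativeSemiring
    using (setoid; distribˡ)
  open SetoidReasoning setoid

  δ-refl : ∀ b → δ b b ≡ 𝟙
  δ-refl b rewrite dec-true (b ≟ b) refl = refl

  -- Over a single letter `b`, an occurrence of `b` in a reversed word contributes `q` to the number
  -- of letters before it. The appended `b` has all of `x` before it, and the other contributions do
  -- not change.
  binomʳ-∷ʳ-letter : ∀ x b →
    binomʳ (x ∷ʳ b) (b ∷ []) ≋ q ^ length x + binomʳ x (b ∷ [])
  binomʳ-∷ʳ-letter [] b = begin
    q ^ 1 * 𝟘 + δ b b * 𝟙  ≈⟨ +-cong (*-zeroʳ (q ^ 1)) (*-identityʳ (δ b b)) ⟩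
    δ b b                  ≡⟨ δ-refl b ⟩
    𝟙 + 𝟘                  ∎
  binomʳ-∷ʳ-letter (c ∷ x) b = begin
    q ^ 1 * binomʳ (x ∷ʳ b) (b ∷ []) + D
      ≈⟨ +-cong (*-congˡ (q ^ 1) (binomʳ-∷ʳ-letter x b)) ≋-refl ⟩
    q ^ 1 * (q ^ length x + B) + D
      ≈⟨ +-cong (distribˡ (q ^ 1) (q ^ length x) B) ≋-refl ⟩
    q ^ 1 * q ^ length x + q ^ 1 * B + D
      ≈⟨ +-assoc (q ^ 1 * q ^ length x) (q ^ 1 * B) D ⟩
    q ^ 1 * q ^ length x + (q ^ 1 * B + D)
      -- `q ^ 1` unfolds to `q * 𝟙`. The bracket `q ^ 1 * B + D` is already
      -- `binomʳ (c ∷ x) (b ∷ [])` by definition.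
      ≈⟨ +-cong (*-cong (*-identityʳ q) (≋-refl {q ^ length x})) ≋-refl ⟩
    q ^ suc (length x) + (q ^ 1 * B + D)  ∎
    where
    B = binomʳ x (b ∷ [])
    D = δ c b * 𝟙

  binom-∷-letter : ∀ x b →
    binom (b ∷ x) (b ∷ []) ≋ q ^ length x + binom x (b ∷ [])
  binom-∷-letter x b
    rewrite unfold-reverse b x | sym (length-reverse x) =
      binomʳ-∷ʳ-letter (reverse x) b

  module _ (p : ℕ) (b : A) (u : List A) (𝔐 : 𝔽[q].Poly p) where
    open CommutativeRing (𝕂 p 𝔐)
      renaming (_+_ to _⊕_; +-congˡ to ⊕-congˡ; setoid to 𝕂-setoid)
      using (_≈_; 1#; ring)
    open RingProperties ring using (+-cancelʳ)
    private
      module ≈ = SetoidReasoning 𝕂-setoid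

    -- Expanding both sides of the second hypothesis leaves `binom x (b ∷ [])` and `β` as
    -- remainders; the first hypothesis identifies them, so they cancel.
    Sim-[]⇒q^length≈1 : ∀ x →
      Sim _≟_ p (b ∷ u) 𝔐 x [] →
      Sim _≟_ p (b ∷ u) 𝔐 (b ∷ x) (b ∷ []) →
      reduce p (q ^ length x) ≈ 1#
    Sim-[]⇒q^length≈1 x x~ε bx~b = +-cancelʳ β (reduce p (q ^ length x)) 1# (≈.begin
      reduce p (q ^ length x) ⊕ β
        ≈.≈⟨ ⊕-congˡ {reduce p (q ^ length x)}
             {reduce p (binom x (b ∷ []))} {β} (x~ε (b ∷ []) b∈u) ⟨
      reduce p (q ^ length x) ⊕ reduce p (binom x (b ∷ []))
        ≈.≈⟨ expand x ⟨
      reduce p (binom (b ∷ x) (b ∷ []))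
        ≈.≈⟨ bx~b (b ∷ []) b∈u ⟩
      reduce p (binom (b ∷ []) (b ∷ []))
        -- Here the power is `q ^ 0`, which reduces to `1#`.
        ≈.≈⟨ expand [] ⟩
      1# ⊕ β  ≈.∎)
      where
      β = reduce p (binom [] (b ∷ []))

      -- The one factor at which both similarities are evaluated.
      b∈u : Fac (b ∷ u) (b ∷ [])
      b∈u = [] , u , refl

      expand : ∀ y → reduce p (binom (b ∷ y) (b ∷ [])) ≈
                     reduce p (q ^ length y) ⊕ reduce p (binom y (b ∷ []))
      expand y = ≈.begin
        reduce p (binom (b ∷ y) (b ∷ []))
          ≈.≈⟨ ≈⇒≈/⟨⟩ (𝔽 p [X]) 𝔐 (reduce-cong p (binom-∷-letter y b)) ⟩
        reduce p (q ^ length y + binom y (b ∷ []))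
          ≈.≡⟨ reduce-+ p (q ^ length y) (binom y (b ∷ [])) ⟩
        reduce p (q ^ length y) ⊕ reduce p (binom y (b ∷ []))  ≈.∎

proposition6p11 : ∀ {a ℓ} {A : Set a} {k : ℕ} (fin : A ↔ Fin k)
    {p : ℕ} → Prime p →
    (u : List A) → u ≢ [] →
    (𝔐 : 𝔽[q].Poly p) {d : ℕ} → 𝔽[q].HasDegree p 𝔐 d → 1 ≤ d →
    (_≅_ : Rel (List A) ℓ) (≅-isCongruence : IsCongruence _≅_) →
    _≅_ ⇒ Sim (finite⇒≟ fin) p u 𝔐 →
    ¬ IsUnit (𝕂 p 𝔐) (𝔽[q].q p) →
    ¬ IsGroupMonoid (quotientMonoid ≅-isCongruence)
    × (∀ w → InvertibleIn (quotientMonoid ≅-isCongruence) w → w ≅ [])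
proposition6p11 fin _ [] u≢[] = contradiction refl u≢[]
proposition6p11 {A = A} fin {p} _ (b ∷ u) _ 𝔐 _ _ _≅_ ≅-isCongruence refines q-nonunit =
    (λ (_⁻¹ , isGroup) →
       b∷≢[] (≅[]⇒≡[] ((b ∷ []) ++ ((b ∷ []) ⁻¹)) (IsGroup.inverseʳ isGroup (b ∷ []))))
  -- A prefix of the empty word is empty.
  , (λ w (v , _ , wv≅ε) → reflexive (++-conicalˡ w v (≅[]⇒≡[] (w ++ v) wv≅ε)))
  where
  open IsCongruence ≅-isCongruence
  open IsEquivalence isEquivalence using (reflexive)

  b∷≢[] : ∀ {x : List A} → b ∷ x ≢ []
  b∷≢[] ()

  -- Were `x` non-empty, some positive power of `q` would equal 1 in `𝕂 p 𝔐`, making `q` a unit. The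
  -- second similarity comes from multiplying `x ≅ []` by `b` on the left.
  ≅[]⇒≡[] : ∀ x → x ≅ [] → x ≡ []
  ≅[]⇒≡[] []      _   = refl
  ≅[]⇒≡[] x@(_ ∷ _) x≅ε = contradiction
    (q^n≈1⇒IsUnit-q p 𝔐 (length x) (λ ())
      (Sim-[]⇒q^length≈1 (finite⇒≟ fin) p b u 𝔐 x
        (refines x≅ε) (refines (++-congˡ {b ∷ []} x≅ε))))
    q-nonunit
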